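{- Let $\mathcal B$ and $\mathcal B'$ be blockchains and let $tx$ be a transaction. (1) If $\mathcal B\cong\mathcal B'$, $\mathrm{valid}(\mathcal B;tx)$ and $\mathrm{valid}(\mathcal B';tx)$, then $\mathcal B;tx\cong\mathcal B';tx$. (2) If $\mathcal B=_\alpha\mathcal B'$ then $\mathcal B\cong\mathcal B'$. (3) Up to $\alpha$-equivalence, if $\mathcal B\cong\mathcal B'$ then $\mathrm{valid}(\mathcal B;tx)\Longleftrightarrow\mathrm{valid}(\mathcal B';tx)$. That is, there exist blockchains $\mathcal B_1=_\alpha\mathcal B$ and $\mathcal B_1'=_\alpha\mathcal B'$ such that, if $\mathcal B_1\cong\mathcal B_1'$, then $\mathrm{valid}(\mathcal B_1;tx)\Longleftrightarrow\mathrm{valid}(\mathcal B_1';tx)$. (4) Up to $\alpha$-equivalence, if $\mathcal B\cong\mathcal B'$ and $\mathrm{valid}(\mathcal B;tx)$ then $\mathcal B;tx\cong\mathcal B';tx$. That is, there exist blockchains $\mathcal B_1=_\alpha\mathcal B$ and $\mathcal B_1'=_\alpha\mathcal B'$ such that, if $\mathcal B_1\cong\mathcal B_1'$ and $\mathrm{valid}(\mathcal B_1;tx)$, then $\mathcal B_1;tx\cong\mathcal B_1';tx$.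
   Context: Idealised EUTxO. Fix a solution of the following type equations (the choice of the subset $\mathsf{Validator}$ is left unspecified): $\mathsf{Redeemer}=\mathsf{CurrencySymbol}=\mathsf{TokenName}=\mathsf{Position}=\mathbb N$; $\mathsf{Chip}=\mathsf{CurrencySymbol}\times\mathsf{TokenName}$; $\mathsf{Datum}=\mathbb N$; $\mathsf{Value}$ is the set of finite partial functions from $\mathsf{Chip}$ to $\mathbb N_{>0}$; $\mathsf{Validator}\subseteq \mathcal P(\mathsf{Redeemer}\times\mathsf{Datum}\times\mathsf{Value}\times\mathsf{Context})$, where $\mathcal P$ is powerset; $\mathsf{Input}=\mathsf{Position}\times\mathsf{Redeemer}$; $\mathsf{Output}=\mathsf{Position}\times\mathsf{Validator}\times\mathsf{Datum}\times\mathsf{Value}$; $\mathsf{Transaction}$ is the set of pairs $(I,O)$ with $I$ a finite subset of $\mathsf{Input}$ and $O$ a finite subset of $\mathsf{Output}$ (either may be empty); $\mathsf{Context}$ is the set of $((I,i),O)$ with $(I,O)\in\mathsf{Transaction}$ and $i\in I$. If $tx=(I,O)$ is a transaction and $i\in I$, write $tx@i$ for the context $((I,i),O)$. An input $i$ points to an output $o$ when $i$ and $o$ have the same position (first component). $\mathit{Txs}$ ranges over finite sequences of transactions; inputs and outputs appearing in $\mathit{Txs}$ are understood as occurrences (in a given transaction of the sequence), and "earlier"/"later" refer to strictly earlier/later transactions in the sequence. A (valid) blockchain is a finite sequence of transactions $\mathit{Txs}$ such that: (i) distinct outputs appearing in $\mathit{Txs}$ have distinct positions; (ii) every input $i$ in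 some $tx$ in $\mathit{Txs}$ points to a unique output, denoted $\mathit{Txs}(i)$, in some earlier transaction, and distinct inputs appearing in $\mathit{Txs}$ have distinct positions; (iii) if an input $i=(p,k)$ appears in $tx$ in $\mathit{Txs}$ and points to the earlier output $\mathit{Txs}(i)=(p,V,s,v)$, then $(k,s,v,tx@i)\in V$. Write $\mathrm{valid}(\mathit{Txs})$ for "$\mathit{Txs}$ is a blockchain". The symbol $;$ denotes concatenation of sequences of transactions (a single transaction being treated as a one-element sequence). For any finite sequence of transactions $\mathit{Txs}$, an output appearing in $\mathit{Txs}$ is spent (in $\mathit{Txs}$) when a later input points to it, and otherwise unspent. $\mathrm{UTxO}(\mathit{Txs})$ is the set of unspent outputs in $\mathit{Txs}$. Write $\mathit{Txs}\cong\mathit{Txs}'$ (observational equivalence) when $\mathrm{UTxO}(\mathit{Txs})=\mathrm{UTxO}(\mathit{Txs}')$. $\alpha$-equivalence: for blockchains, $\mathcal B=_\alpha\mathcal B'$ when $\mathcal B$ and $\mathcal B'$ differ only in their choice of positions of spent output-input pairs; i.e. $\mathcal B'$ is obtained from $\mathcal B$ by applying to the position component of every input and output appearing in $\mathcal B$ a permutation of $\mathbb N$ that fixes the positions of all unspent outputs of $\mathcal B$ (redeemers, validators, data and values are unchanged). This is an equivalence relation. Standing assumption: the choice of position of a spent output-input pair is irrelevant, i.e. renaming positions in a blockchain in the manner just described again yields a blockchain. "Up to $\alpha$-equivalence, $\Phi$" means: there exist $\alpha$-equivalent forms of the (blockchain) arguments of $\Phi$ such that $\Phi$ is true of those arguments.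 -}

module Defs where

open import Data.Fin as Fin using (Fin)
open import Data.List using (List; []; _∷_; _++_; [_]; length; lookup; map)
open import Data.List.Membership.Propositional using (_∈_)
open import Data.List.Relation.Binary.BagAndSetEquality using (_∼[_]_; set)
open import Data.List.Relation.Binary.Pointwise using (Pointwise)
open import Data.List.Relation.Unary.All using (All)
open import Data.List.Relation.Unary.AllPairs using (AllPairs)
open import Data.Nat using (ℕ; NonZero; _<_)
open import Data.Product using (Σ; ∃; ∃₂; ∃!; _×_; _,_; proj₁; proj₂)
open import Data.Product.Relation.Binary.Lex.Strict using (×-Lex)
open import Function.Bundles using (_↔_; _⇔_; Inverse)
open import Level using (Level; _⊔_; suc)
open import Relation.Binary.PropositionalEquality using (_≡_)
open import Relation.Nullary using (¬_)
open import Relation.Unary using (Pred; _≐_)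

Redeemer CurrencySymbol TokenName Position Datum Chip : Set
Redeemer       = ℕ
CurrencySymbol = ℕ
TokenName      = ℕ
Position       = ℕ
Datum          = ℕ
Chip           = CurrencySymbol × TokenName

_<ᶜ_ : Chip → Chip → Set
_<ᶜ_ = ×-Lex _≡_ _<_ _<_

-- A finite partial function Chip ⇀ ℕ_{>0}, as its graph listed in strictly
-- increasing order of chips.  The proofs are irrelevant, so _≡_ on Value is
-- equality of partial functions.
record Value : Set where
  constructor mkValue
  field
    graph     : List (Chip × ℕ)
    .sorted   : AllPairs _<ᶜ_ (map proj₁ graph)
    .positive : All (λ e → NonZero (proj₂ e)) graph

record Input : Set where
  constructor mkInput
  field
    position : Position
    redeemer : Redeemer

record Output {v : Level} (V : Set v) : Set v where
  constructor mkOutput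
  field
    position  : Position
    validator : V
    datum     : Datum
    value     : Value

-- Finite subsets are lists, identified when they have the same elements
-- (_≈ᵗ_ below); order and repetitions carry no information.
record Transaction {v : Level} (V : Set v) : Set v where
  constructor transaction
  field
    inputs  : List Input
    outputs : List (Output V)

record Context {v : Level} (V : Set v) : Set v where
  constructor context
  field
    tx        : Transaction V
    redeemed  : Input
    redeemed∈ : redeemed ∈ Transaction.inputs tx

_≈ᵗ_ : {v : Level} {V : Set v} → Transaction V → Transaction V → Set v
t ≈ᵗ t′ = (inputs t ∼[ set ] inputs t′) × (outputs t ∼[ set ] outputs t′)
  where open Transaction

_≈ᶜ_ : {v : Level} {V : Set v} → Context V → Context V → Set v
c ≈ᶜ c′ = (tx c ≈ᵗ tx c′) × (redeemed c ≡ redeemed c′)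
  where open Context

-- A solution of the type equations.  Validator ⊆ 𝒫(…) is given by an
-- embedding into predicates: `accepts` makes each validator a predicate that
-- does not depend on how the finite sets in a context are listed, and
-- `extensional` says that validators are determined by their elements.
record EUTxO (v p : Level) : Set (suc (v ⊔ p)) where
  field
    Validator    : Set v
    accepts      : Validator → Redeemer → Datum → Value → Context Validator → Set p
    accepts-resp : ∀ V k s x {c c′} → c ≈ᶜ c′ → accepts V k s x c → accepts V k s x c′
    extensional  : ∀ V W → (∀ k s x c → accepts V k s x c ⇔ accepts W k s x c) → V ≡ W

module Ledger {v p : Level} (S : EUTxO v p) where

  open EUTxO S

  Tx : Set v
  Tx = Transaction Validator

  Out : Set v
  Out = Output Validator

  -- Occurrences of inputs and outputs are pairs (j , i) and (j , o), where j
  -- is the place in the sequence of the transaction containing i or o.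
  InputAt : (Txs : List Tx) → Fin (length Txs) → Input → Set
  InputAt Txs j i = i ∈ Transaction.inputs (lookup Txs j)

  OutputAt : (Txs : List Tx) → Fin (length Txs) → Out → Set v
  OutputAt Txs j o = o ∈ Transaction.outputs (lookup Txs j)

  _pointsTo_ : Input → Out → Set
  i pointsTo o = Input.position i ≡ Output.position o

  -- Distinctness of positions is stated positively, as injectivity of
  -- position on occurrences.
  record Valid (Txs : List Tx) : Set (v ⊔ p) where
    field
      outputs-distinct : ∀ {j k o o′} → OutputAt Txs j o → OutputAt Txs k o′ →
                         Output.position o ≡ Output.position o′ → (j , o) ≡ (k , o′)
      source           : ∀ {k i} → InputAt Txs k i →
                         ∃! _≡_ λ ((j , o) : Fin (length Txs) × Out) →
                           OutputAt Txs j o × j Fin.< k × i pointsTo o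
      inputs-distinct  : ∀ {j k i i′} → InputAt Txs j i → InputAt Txs k i′ →
                         Input.position i ≡ Input.position i′ → (j , i) ≡ (k , i′)
      validated        : ∀ {j k i o} (i∈ : InputAt Txs k i) →
                         OutputAt Txs j o → j Fin.< k → i pointsTo o →
                         accepts (Output.validator o) (Input.redeemer i)
                                 (Output.datum o) (Output.value o)
                                 (context (lookup Txs k) i i∈)

  Blockchain : Set (v ⊔ p)
  Blockchain = Σ (List Tx) Valid

  txs : Blockchain → List Tx
  txs = proj₁

  SpentAt : (Txs : List Tx) → Fin (length Txs) → Out → Set
  SpentAt Txs j o = ∃₂ λ k i → j Fin.< k × InputAt Txs k i × i pointsTo o

  UTxO : List Tx → Pred Out v
  UTxO Txs o = ∃ λ j → OutputAt Txs j o × ¬ SpentAt Txs j o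

  infix 4 _≅_ _=α_

  _≅_ : List Tx → List Tx → Set v
  Txs ≅ Txs′ = UTxO Txs ≐ UTxO Txs′

  renameInput : (Position → Position) → Input → Input
  renameInput π (mkInput q k) = mkInput (π q) k

  renameOutput : (Position → Position) → Out → Out
  renameOutput π (mkOutput q V s x) = mkOutput (π q) V s x

  renameTx : (Position → Position) → Tx → Tx
  renameTx π (transaction I O) = transaction (map (renameInput π) I) (map (renameOutput π) O)

  rename : ℕ ↔ ℕ → List Tx → List Tx
  rename π = map (renameTx (Inverse.to π))

  FixesUnspent : ℕ ↔ ℕ → List Tx → Set v
  FixesUnspent π Txs = ∀ {o} → UTxO Txs o →
    Inverse.to π (Output.position o) ≡ Output.position o

  _=α_ : Blockchain → Blockchain → Set v
  B =α B′ = ∃ λ π → FixesUnspent π (txs B) × Pointwise _≈ᵗ_ (rename π (txs B)) (txs B′)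

  -- The standing assumption that positions of spent outputs are irrelevant.
  -- It constrains the choice of Validator, since a validator can inspect
  -- the positions occurring in its context.
  PositionsIrrelevant : Set (v ⊔ p)
  PositionsIrrelevant = ∀ (B : Blockchain) π → FixesUnspent π (txs B) → Valid (rename π (txs B))

{-# OPTIONS --safe #-}

-- Whether tx can be appended to a blockchain B depends only on UTxO(B), except
-- for one condition: no output of tx may reuse the position of a spent output
-- of B.  In a blockchain the spent outputs are those whose position is the
-- position of an input, so for (3) both chains are first renamed by the
-- involution that exchanges each input position p with N + p, where N exceeds
-- every output position of the chain and of tx.  Parts (1) and (4) hold because
-- UTxO(B;tx) is a function of UTxO(B) and tx, whether or not the sequences are
-- valid.

module Submission where

open import Defs
open import Data.Fin as Fin using (Fin; zero; suc; toℕ; cast)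
import Data.Fin.Properties as Fin
open import Data.List using (List; []; _∷_; _∷ʳ_; _++_; [_]; length; lookup; map; concatMap)
open import Data.List.Extrema.Nat using (max; xs≤max)
open import Data.List.Membership.Propositional using (_∈_; find; lose)
open import Data.List.Membership.Propositional.Properties
  using (∈-map⁺; ∈-map⁻; ∈-concatMap⁺; ∈-lookup)
open import Data.List.Properties using (length-map; map-∘; map-id-local)
open import Data.List.Relation.Binary.Pointwise as Pointwise using (Pointwise; []; _∷_)
import Data.List.Relation.Unary.All as All
import Data.List.Relation.Unary.Any as Any
open import Data.Nat using (ℕ; suc; _+_; _∸_; _≤_; _<_; _≟_; _≤?_; s≤s; z<s; s<s; s<s⁻¹)
open import Data.Nat.Properties
  using (<⇒≱; m≤m+n; m+n∸m≡n; m+[n∸m]≡n; suc-injective)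
open import Data.Product using (∃; ∃₂; ∃!; _×_; _,_; proj₁; proj₂)
open import Data.Sum using (_⊎_; inj₁; inj₂)
open import Function using (_∘_)
open import Function.Bundles using (_↔_; _⇔_; Inverse; Injection; Equivalence; mk⇔; mk↔ₛ′)
open import Function.Related.Propositional using (K-refl)
open import Function.Properties.Inverse using (↔-sym; ↔⇒↣)
open import Level using (Level; _⊔_)
open import Relation.Binary.Core using (REL)
open import Relation.Binary.PropositionalEquality
  using (_≡_; _≢_; refl; sym; trans; cong; cong₂; subst; subst₂)
open import Relation.Nullary using (¬_; Dec; yes; no; contradiction)
open import Relation.Nullary.Decidable using (map′; _×-dec_)
open import Relation.Unary using (Pred; Decidable)

-- Indices into a list extended by one element at the end.

private
  variable
    a b c r : Level
    A : Set a
    B : Set b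
    C : Set c

-- Defined by recursion on the list because `length (xs ∷ʳ x)` does not reduce to `suc (length xs)`;
-- the usual embedding of `Fin n` into `Fin (suc n)` would require casts. The same holds for `new`.
old : (xs : List A) {x : A} → Fin (length xs) → Fin (length (xs ∷ʳ x))
old (_ ∷ _)  zero    = zero
old (_ ∷ xs) (suc j) = suc (old xs j)

new : (xs : List A) {x : A} → Fin (length (xs ∷ʳ x))
new []       = zero
new (_ ∷ xs) = suc (new xs)

lookup-old : ∀ (xs : List A) {x} j → lookup (xs ∷ʳ x) (old xs {x} j) ≡ lookup xs j
lookup-old (_ ∷ _)  zero    = refl
lookup-old (_ ∷ xs) (suc j) = lookup-old xs j

lookup-new : ∀ (xs : List A) {x} → lookup (xs ∷ʳ x) (new xs {x}) ≡ x
lookup-new []       = refl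
lookup-new (_ ∷ xs) = lookup-new xs

old<new : ∀ (xs : List A) {x} j → old xs {x} j Fin.< new xs {x}
old<new (_ ∷ _)  zero    = z<s
old<new (_ ∷ xs) (suc j) = s<s (old<new xs j)

old-mono-< : ∀ (xs : List A) {x j k} → j Fin.< k → old xs {x} j Fin.< old xs {x} k
old-mono-< (_ ∷ _)  {j = zero}  {suc _} _   = z<s
old-mono-< (_ ∷ xs) {j = suc _} {suc _} j<k = s<s (old-mono-< xs (s<s⁻¹ j<k))

old-cancel-< : ∀ (xs : List A) {x j k} → old xs {x} j Fin.< old xs {x} k → j Fin.< k
old-cancel-< (_ ∷ _)  {j = zero}  {suc _} _   = z<s
old-cancel-< (_ ∷ xs) {j = suc _} {suc _} j<k = s<s (old-cancel-< xs (s<s⁻¹ j<k))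

new≮ : ∀ (xs : List A) {x} (j : Fin (length (xs ∷ʳ x))) → ¬ new xs {x} Fin.< j
new≮ []       zero    ()
new≮ (_ ∷ xs) (suc j) new<j = new≮ xs j (s<s⁻¹ new<j)

old-or-new : ∀ (xs : List A) {x} j → (∃ λ i → old xs {x} i ≡ j) ⊎ new xs {x} ≡ j
old-or-new []       zero    = inj₂ refl
old-or-new (_ ∷ _)  zero    = inj₁ (zero , refl)
old-or-new (_ ∷ xs) (suc j) with old-or-new xs j
... | inj₁ (i , refl) = inj₁ (suc i , refl)
... | inj₂ refl       = inj₂ refl

old-injective : ∀ (xs : List A) {x j k} → old xs {x} j ≡ old xs {x} k → j ≡ k
old-injective (_ ∷ _)  {j = zero}  {zero}  _  = refl
old-injective (_ ∷ xs) {j = suc _} {suc _} eq = cong suc (old-injective xs (Fin.suc-injective eq))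

old≢new : ∀ (xs : List A) {x j} → old xs {x} j ≢ new xs {x}
old≢new (_ ∷ _)  {j = zero}  ()
old≢new (_ ∷ xs) {j = suc _} eq = old≢new xs (Fin.suc-injective eq)

-- The two indices live in different `Fin` types, so they are matched through `toℕ`. This keeps
-- casts out of the statements about renaming.
lookup-Pointwise-mapˡ : {R : REL B A r} {f : C → B} {xs : List C} {ys : List A} →
                        Pointwise R (map f xs) ys →
                        ∀ {j k} → toℕ j ≡ toℕ k → R (f (lookup xs j)) (lookup ys k)
lookup-Pointwise-mapˡ {xs = _ ∷ _} (x∼y ∷ _)     {zero}  {zero}  _  = x∼y
lookup-Pointwise-mapˡ {xs = _ ∷ _} (_   ∷ xs∼ys) {suc _} {suc _} eq =
  lookup-Pointwise-mapˡ xs∼ys (suc-injective eq)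

-- An involution that moves a bounded decidable set of naturals above its bound.

module Relocation {ℓ} {P : Pred ℕ ℓ} (P? : Decidable P)
                  {N : ℕ} (bounded : ∀ {p} → P p → p < N) where

  -- The test `N ≤? p` guards against truncated subtraction: for `p` below `N`, `p ∸ N` is 0, which
  -- may satisfy `P`.
  relocate : ℕ → ℕ
  relocate p with P? p
  ... | yes _ = N + p
  ... | no  _ with N ≤? p | P? (p ∸ N)
  ...   | yes _ | yes _ = p ∸ N
  ...   | _     | _     = p

  N+p∉P : ∀ {p} → ¬ P (N + p)
  N+p∉P P[N+p] = <⇒≱ (bounded P[N+p]) (m≤m+n N _)

  relocate-∈ : ∀ {p} → P p → relocate p ≡ N + p
  relocate-∈ {p} Pp with P? p
  ... | yes _  = refl
  ... | no ¬Pp = contradiction Pp ¬Pp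

  relocate-fixes : ∀ {p} → ¬ P p → p < N → relocate p ≡ p
  relocate-fixes {p} ¬Pp p<N with P? p
  ... | yes Pp = contradiction Pp ¬Pp
  ... | no  _ with N ≤? p | P? (p ∸ N)
  ...   | yes N≤p | yes _ = contradiction N≤p (<⇒≱ p<N)
  ...   | yes _   | no  _ = refl
  ...   | no  _   | _     = refl

  relocate-back : ∀ {p} → P p → relocate (N + p) ≡ p
  relocate-back {p} Pp with P? (N + p)
  ... | yes P[N+p] = contradiction P[N+p] N+p∉P
  ... | no  _ with N ≤? N + p | P? (N + p ∸ N)
  ...   | yes _   | yes _ = m+n∸m≡n N p
  ...   | yes _   | no ¬P = contradiction (subst P (sym (m+n∸m≡n N p)) Pp) ¬P
  ...   | no  N≰  | _     = contradiction (m≤m+n N p) N≰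

  relocate-involutive : ∀ p → relocate (relocate p) ≡ p
  relocate-involutive p with P? p in eq
  ... | yes Pp = relocate-back Pp
  ... | no  _ with N ≤? p in eq₁ | P? (p ∸ N) in eq₂
  ...   | yes N≤p | yes Pq = trans (relocate-∈ Pq) (m+[n∸m]≡n N≤p)
  -- The inner call has returned `p`, so the outer call runs the same tests on `p` again; the
  -- recorded outcomes decide them.
  ...   | yes _   | no  _ rewrite eq | eq₁ | eq₂ = refl
  ...   | no  _   | _     rewrite eq | eq₁       = refl

  relocation : ℕ ↔ ℕ
  relocation = mk↔ₛ′ relocate relocate relocate-involutive relocate-involutive

module _ {v p : Level} (S : EUTxO v p) where

  open EUTxO S
  open Ledger S
  open Transaction using (inputs; outputs)

  private
    variable
      Txs Txs′ : List Tx
      tx : Tx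
      i i′ : Input
      o o′ : Out

  -- Spending, and occurrences in an extended sequence.

  _spends_ : Tx → Out → Set
  tx spends o = ∃ λ i → i ∈ inputs tx × i pointsTo o

  -- Allows `Appendable-resp-≅` to split outputs into spent and unspent ones without excluded
  -- middle.
  spentAt? : ∀ Txs j o → Dec (SpentAt Txs j o)
  spentAt? Txs j o = map′
    (λ (k , j<k , i∈) → let i , i∈ , i↦o = find i∈ in k , i , j<k , i∈ , i↦o)
    (λ (k , i , j<k , i∈ , i↦o) → k , j<k , lose i∈ i↦o)
    (Fin.any? λ k → (j Fin.<? k) ×-dec
      Any.any? (λ i → Input.position i ≟ Output.position o) (inputs (lookup Txs k)))

  outputPositions : List Tx → List Position
  outputPositions = concatMap (map Output.position ∘ outputs)

  ∈-outputPositions : ∀ Txs {j o} → OutputAt Txs j o → Output.position o ∈ outputPositions Txs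
  ∈-outputPositions Txs {j} o∈ =
    ∈-concatMap⁺ (map Output.position ∘ outputs) {xs = Txs} (lose (∈-lookup j) (∈-map⁺ Output.position o∈))

  oldOutput : ∀ Txs {tx j} → OutputAt Txs j o → OutputAt (Txs ∷ʳ tx) (old Txs {tx} j) o
  oldOutput {o = o} Txs {j = j} = subst (λ t → o ∈ outputs t) (sym (lookup-old Txs j))

  oldOutput⁻ : ∀ Txs {tx j} → OutputAt (Txs ∷ʳ tx) (old Txs j) o → OutputAt Txs j o
  oldOutput⁻ {o = o} Txs {j = j} = subst (λ t → o ∈ outputs t) (lookup-old Txs j)

  newOutput : ∀ Txs → o ∈ outputs tx → OutputAt (Txs ∷ʳ tx) (new Txs) o
  newOutput {o = o} Txs = subst (λ t → o ∈ outputs t) (sym (lookup-new Txs))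

  newOutput⁻ : ∀ Txs → OutputAt (Txs ∷ʳ tx) (new Txs) o → o ∈ outputs tx
  newOutput⁻ {o = o} Txs = subst (λ t → o ∈ outputs t) (lookup-new Txs)

  oldInput : ∀ Txs {tx j} → InputAt Txs j i → InputAt (Txs ∷ʳ tx) (old Txs j) i
  oldInput {i = i} Txs {j = j} = subst (λ t → i ∈ inputs t) (sym (lookup-old Txs j))

  oldInput⁻ : ∀ Txs {tx j} → InputAt (Txs ∷ʳ tx) (old Txs j) i → InputAt Txs j i
  oldInput⁻ {i = i} Txs {j = j} = subst (λ t → i ∈ inputs t) (lookup-old Txs j)

  newInput : ∀ Txs → i ∈ inputs tx → InputAt (Txs ∷ʳ tx) (new Txs) i
  newInput {i = i} Txs = subst (λ t → i ∈ inputs t) (sym (lookup-new Txs))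

  newInput⁻ : ∀ Txs → InputAt (Txs ∷ʳ tx) (new Txs) i → i ∈ inputs tx
  newInput⁻ {i = i} Txs = subst (λ t → i ∈ inputs t) (lookup-new Txs)

  -- Unspent outputs of an extended sequence.

  UTxO-∷ʳ⁻ : ∀ Txs → UTxO (Txs ∷ʳ tx) o → (UTxO Txs o × ¬ tx spends o) ⊎ o ∈ outputs tx
  UTxO-∷ʳ⁻ Txs (j , o∈ , unspent) with old-or-new Txs j
  ... | inj₂ refl       = inj₂ (newOutput⁻ Txs o∈)
  ... | inj₁ (j′ , refl) = inj₁
    ( ( j′ , oldOutput⁻ Txs o∈
      , λ (k , i , j<k , i∈ , i↦o) →
          unspent (old Txs k , i , old-mono-< Txs j<k , oldInput Txs i∈ , i↦o))
    , λ (i , i∈ , i↦o) → unspent (new Txs , i , old<new Txs j′ , newInput Txs i∈ , i↦o))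

  UTxO-∷ʳ⁺ : ∀ Txs → (UTxO Txs o × ¬ tx spends o) ⊎ o ∈ outputs tx → UTxO (Txs ∷ʳ tx) o
  -- Only a strictly later input spends, and nothing is later than `tx`; its own inputs do not
  -- count.
  UTxO-∷ʳ⁺ Txs (inj₂ o∈) =
    new Txs , newOutput Txs o∈ , λ (k , _ , new<k , _) → new≮ Txs k new<k
  UTxO-∷ʳ⁺ {o = o} {tx = tx} Txs (inj₁ ((j , o∈ , unspent) , unspent-by-tx)) =
    old Txs j , oldOutput Txs o∈ , still-unspent
    where
    still-unspent : ¬ SpentAt (Txs ∷ʳ tx) (old Txs j) o
    still-unspent (k , i , j<k , i∈ , i↦o) with old-or-new Txs k
    ... | inj₂ refl        = unspent-by-tx (i , newInput⁻ Txs i∈ , i↦o)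
    ... | inj₁ (k′ , refl) = unspent (k′ , i , old-cancel-< Txs j<k , oldInput⁻ Txs i∈ , i↦o)

  ≅-∷ʳ : ∀ Txs Txs′ → Txs ≅ Txs′ → Txs ∷ʳ tx ≅ Txs′ ∷ʳ tx
  ≅-∷ʳ {tx = tx} Txs Txs′ (⊆ , ⊇) = extend Txs Txs′ ⊆ , extend Txs′ Txs ⊇
    where
    extend : ∀ Us Us′ → (∀ {o} → UTxO Us o → UTxO Us′ o) →
             ∀ {o} → UTxO (Us ∷ʳ tx) o → UTxO (Us′ ∷ʳ tx) o
    extend Us Us′ Us⊆Us′ u with UTxO-∷ʳ⁻ Us u
    ... | inj₁ (u′ , unspent) = UTxO-∷ʳ⁺ Us′ (inj₁ (Us⊆Us′ u′ , unspent))
    ... | inj₂ o∈             = UTxO-∷ʳ⁺ Us′ (inj₂ o∈)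

  -- Validity of an extension as conditions on the appended transaction.

  record Appendable (Txs : List Tx) (tx : Tx) : Set (v ⊔ p) where
    field
      outputs-distinct : o ∈ outputs tx → o′ ∈ outputs tx →
                         Output.position o ≡ Output.position o′ → o ≡ o′
      -- The only field that sees spent outputs of `Txs`; `source` depends on `Txs` through `UTxO`
      -- alone.
      outputs-fresh    : ∀ {j} → OutputAt Txs j o → o′ ∈ outputs tx →
                         Output.position o ≢ Output.position o′
      inputs-distinct  : i ∈ inputs tx → i′ ∈ inputs tx →
                         Input.position i ≡ Input.position i′ → i ≡ i′
      source           : (i∈ : i ∈ inputs tx) → ∃ λ o → UTxO Txs o × i pointsTo o ×
                         accepts (Output.validator o) (Input.redeemer i)
                                 (Output.datum o) (Output.value o) (context tx i i∈)

  ≈ᵗ-refl : ∀ {t : Tx} → t ≈ᵗ t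
  ≈ᵗ-refl = (λ {_} → K-refl) , (λ {_} → K-refl)

  -- Even over equal transactions the two membership proofs may differ. Since `_≈ᶜ_` ignores them,
  -- `accepts-resp` bridges the gap.
  accepts-context : ∀ {V k s x t t′} → t ≡ t′ →
                    {i∈ : i ∈ inputs t} {i∈′ : i ∈ inputs t′} →
                    accepts V k s x (context t i i∈) → accepts V k s x (context t′ i i∈′)
  accepts-context refl = accepts-resp _ _ _ _ (≈ᵗ-refl , refl)

  Valid-∷ʳ⇒Appendable : ∀ Txs → Valid (Txs ∷ʳ tx) → Appendable Txs tx
  Valid-∷ʳ⇒Appendable {tx = tx} Txs valid = record
    { outputs-distinct = λ o∈ o′∈ eq →
        cong proj₂ (V.outputs-distinct (newOutput Txs o∈) (newOutput Txs o′∈) eq)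
    ; outputs-fresh = λ o∈ o′∈ eq →
        old≢new Txs (cong proj₁ (V.outputs-distinct (oldOutput Txs o∈) (newOutput Txs o′∈) eq))
    ; inputs-distinct = λ i∈ i′∈ eq →
        cong proj₂ (V.inputs-distinct (newInput Txs i∈) (newInput Txs i′∈) eq)
    ; source = source
    }
    where
    module V = Valid valid

    source : (i∈ : i ∈ inputs tx) → ∃ λ o → UTxO Txs o × i pointsTo o ×
             accepts (Output.validator o) (Input.redeemer i)
                     (Output.datum o) (Output.value o) (context tx i i∈)
    source i∈ with V.source (newInput Txs i∈)
    ... | (j , o) , (o∈ , j<new , i↦o) , _ with old-or-new Txs j
    ...   | inj₂ refl        = contradiction j<new (new≮ Txs _)
    ...   | inj₁ (j′ , refl) =
      o , (j′ , oldOutput⁻ Txs o∈ , unspent) , i↦o ,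
      accepts-context (lookup-new Txs) (V.validated (newInput Txs i∈) o∈ j<new i↦o)
      where
      unspent : ¬ SpentAt Txs j′ o
      -- An input of `Txs` spending `o` would share its position with the input of `tx`, forcing an
      -- old index to equal the new one.
      unspent (k , i′ , _ , i′∈ , i′↦o) = old≢new Txs (cong proj₁
        (V.inputs-distinct (oldInput Txs i′∈) (newInput Txs i∈) (trans i′↦o (sym i↦o))))

  Appendable⇒Valid-∷ʳ : ∀ Txs → Valid Txs → Appendable Txs tx → Valid (Txs ∷ʳ tx)
  Appendable⇒Valid-∷ʳ {tx = tx} Txs valid appendable = record
    { outputs-distinct = outputs-distinct
    ; source           = source
    ; inputs-distinct  = inputs-distinct
    ; validated        = validated
    }
    where
    module V = Valid valid
    module A = Appendable appendable

    outputs-distinct : ∀ {j k o o′} → OutputAt (Txs ∷ʳ tx) j o → OutputAt (Txs ∷ʳ tx) k o′ →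
                       Output.position o ≡ Output.position o′ → (j , o) ≡ (k , o′)
    outputs-distinct {j} {k} o∈ o′∈ eq with old-or-new Txs j | old-or-new Txs k
    ... | inj₁ (_ , refl) | inj₁ (_ , refl) =
      cong (λ (j , o) → old Txs j , o) (V.outputs-distinct (oldOutput⁻ Txs o∈) (oldOutput⁻ Txs o′∈) eq)
    ... | inj₁ (_ , refl) | inj₂ refl =
      contradiction eq (A.outputs-fresh (oldOutput⁻ Txs o∈) (newOutput⁻ Txs o′∈))
    ... | inj₂ refl | inj₁ (_ , refl) =
      contradiction (sym eq) (A.outputs-fresh (oldOutput⁻ Txs o′∈) (newOutput⁻ Txs o∈))
    ... | inj₂ refl | inj₂ refl =
      cong (new Txs ,_) (A.outputs-distinct (newOutput⁻ Txs o∈) (newOutput⁻ Txs o′∈) eq)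

    Source : ∀ k → Input → Fin (length (Txs ∷ʳ tx)) × Out → Set v
    Source k i (j , o) = OutputAt (Txs ∷ʳ tx) j o × j Fin.< k × i pointsTo o

    existsSource : ∀ {k i} → InputAt (Txs ∷ʳ tx) k i → ∃ (Source k i)
    existsSource {k} i∈ with old-or-new Txs k
    ... | inj₁ (_ , refl) =
      let (j , o) , (o∈ , j<k , i↦o) , _ = V.source (oldInput⁻ Txs i∈)
      in (old Txs j , o) , oldOutput Txs o∈ , old-mono-< Txs j<k , i↦o
    ... | inj₂ refl =
      let o , (j , o∈ , _) , i↦o , _ = A.source (newInput⁻ Txs i∈)
      in (old Txs j , o) , oldOutput Txs o∈ , old<new Txs j , i↦o

    source : ∀ {k i} → InputAt (Txs ∷ʳ tx) k i → ∃! _≡_ (Source k i)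
    source i∈ =
      let jo , o∈ , j<k , i↦o = existsSource i∈
      in jo , (o∈ , j<k , i↦o) ,
         -- Any two sources share the position of `i`, so distinctness of output positions gives
         -- uniqueness.
         λ (o′∈ , _ , i↦o′) → outputs-distinct o∈ o′∈ (trans (sym i↦o) i↦o′)

    -- Inputs at one position point to the same output, but the source of an input of `tx` is
    -- unspent in `Txs`.
    old-new-distinct : ∀ {k} → InputAt Txs k i → i′ ∈ inputs tx →
                       Input.position i ≢ Input.position i′
    old-new-distinct {i = i} i∈ i′∈ eq with V.source i∈ | A.source i′∈
    ... | _ , (o∈ , j<k , i↦o) , _ | _ , (_ , o′∈ , unspent) , i′↦o′ , _
      with V.outputs-distinct o∈ o′∈ (trans (sym i↦o) (trans eq i′↦o′))
    ... | refl = unspent (_ , i , j<k , i∈ , i↦o)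

    inputs-distinct : ∀ {j k i i′} → InputAt (Txs ∷ʳ tx) j i → InputAt (Txs ∷ʳ tx) k i′ →
                      Input.position i ≡ Input.position i′ → (j , i) ≡ (k , i′)
    inputs-distinct {j} {k} i∈ i′∈ eq with old-or-new Txs j | old-or-new Txs k
    ... | inj₁ (_ , refl) | inj₁ (_ , refl) =
      cong (λ (j , i) → old Txs j , i) (V.inputs-distinct (oldInput⁻ Txs i∈) (oldInput⁻ Txs i′∈) eq)
    ... | inj₁ (_ , refl) | inj₂ refl =
      contradiction eq (old-new-distinct (oldInput⁻ Txs i∈) (newInput⁻ Txs i′∈))
    ... | inj₂ refl | inj₁ (_ , refl) =
      contradiction (sym eq) (old-new-distinct (oldInput⁻ Txs i′∈) (newInput⁻ Txs i∈))
    ... | inj₂ refl | inj₂ refl =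
      cong (new Txs ,_) (A.inputs-distinct (newInput⁻ Txs i∈) (newInput⁻ Txs i′∈) eq)

    validated : ∀ {j k i o} (i∈ : InputAt (Txs ∷ʳ tx) k i) →
                OutputAt (Txs ∷ʳ tx) j o → j Fin.< k → i pointsTo o →
                accepts (Output.validator o) (Input.redeemer i)
                        (Output.datum o) (Output.value o)
                        (context (lookup (Txs ∷ʳ tx) k) i i∈)
    validated {j} {k} i∈ o∈ j<k i↦o with old-or-new Txs k
    -- The output supplied by `A.source` and `o` both sit at the position of `i`, hence coincide,
    -- and the acceptance recorded for the former applies to `o`.
    ... | inj₂ refl with A.source (newInput⁻ Txs i∈)
    ...   | _ , (_ , o′∈ , _) , i↦o′ , accepted
      with outputs-distinct (oldOutput Txs o′∈) o∈ (trans (sym i↦o′) i↦o)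
    ...   | refl = accepts-context (sym (lookup-new Txs)) accepted
    validated {j} {k} i∈ o∈ j<k i↦o | inj₁ (k′ , refl) with old-or-new Txs j
    ... | inj₂ refl       = contradiction j<k (new≮ Txs _)
    ... | inj₁ (_ , refl) = accepts-context (sym (lookup-old Txs k′))
      (V.validated (oldInput⁻ Txs i∈) (oldOutput⁻ Txs o∈) (old-cancel-< Txs j<k) i↦o)

  -- Transfer of validity along observational equivalence.

  AvoidsInputs : List Tx → Tx → Set v
  AvoidsInputs Txs tx = ∀ {k i o} → InputAt Txs k i → o ∈ outputs tx → ¬ i pointsTo o

  -- Sources transfer because they are unspent. For freshness, suppose an output of `Txs′` shares a
  -- position with one of `tx`. If it is spent, its spender has a position that `tx` avoids; if it
  -- is unspent, it also occurs in `Txs`, where freshness is known.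
  Appendable-resp-≅ : ∀ Txs Txs′ → Txs ≅ Txs′ → AvoidsInputs Txs′ tx →
                      Appendable Txs tx → Appendable Txs′ tx
  Appendable-resp-≅ {tx = tx} Txs Txs′ (⊆ , ⊇) avoids appendable = record
    { outputs-distinct = A.outputs-distinct
    ; outputs-fresh    = outputs-fresh
    ; inputs-distinct  = A.inputs-distinct
    ; source           = λ i∈ → let o , u , rest = A.source i∈ in o , ⊆ u , rest
    }
    where
    module A = Appendable appendable

    outputs-fresh : ∀ {j} → OutputAt Txs′ j o → o′ ∈ outputs tx →
                    Output.position o ≢ Output.position o′
    outputs-fresh {o = o} {j = j} o∈ o′∈ eq with spentAt? Txs′ j o
    ... | yes (_ , _ , _ , i∈ , i↦o) = avoids i∈ o′∈ (trans i↦o eq)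
    ... | no unspent = A.outputs-fresh (proj₁ (proj₂ (⊇ (j , o∈ , unspent)))) o′∈ eq

  Valid-∷ʳ-resp-≅ : ∀ Txs Txs′ → Valid Txs′ → Txs ≅ Txs′ → AvoidsInputs Txs′ tx →
                    Valid (Txs ∷ʳ tx) → Valid (Txs′ ∷ʳ tx)
  Valid-∷ʳ-resp-≅ Txs Txs′ valid′ equiv avoids =
    Appendable⇒Valid-∷ʳ Txs′ valid′ ∘ Appendable-resp-≅ Txs Txs′ equiv avoids ∘ Valid-∷ʳ⇒Appendable Txs

  -- Renaming of positions and α-equivalence.

  module Renaming (π : ℕ ↔ ℕ) {Txs Txs′ : List Tx}
                  (renamed : Pointwise _≈ᵗ_ (rename π Txs) Txs′) where

    open Inverse π using (to)
    open Injection (↔⇒↣ π) using (injective)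

    private
      variable
        j : Fin (length Txs)
        j′ : Fin (length Txs′)

    at : toℕ j ≡ toℕ j′ → renameTx to (lookup Txs j) ≈ᵗ lookup Txs′ j′
    at = lookup-Pointwise-mapˡ renamed

    same-length : length Txs ≡ length Txs′
    same-length = trans (sym (length-map (renameTx to) Txs)) (Pointwise.Pointwise-length renamed)

    forth : (j : Fin (length Txs)) → ∃ λ (j′ : Fin (length Txs′)) → toℕ j ≡ toℕ j′
    forth j = cast same-length j , sym (Fin.toℕ-cast same-length j)

    back : (j′ : Fin (length Txs′)) → ∃ λ (j : Fin (length Txs)) → toℕ j ≡ toℕ j′
    back j′ = cast (sym same-length) j′ , Fin.toℕ-cast (sym same-length) j′

    renameOutputAt : toℕ j ≡ toℕ j′ → OutputAt Txs j o → OutputAt Txs′ j′ (renameOutput to o)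
    renameOutputAt eq o∈ = Equivalence.to (proj₂ (at eq)) (∈-map⁺ (renameOutput to) o∈)

    renameOutputAt⁻ : toℕ j ≡ toℕ j′ → OutputAt Txs′ j′ o′ →
                      ∃ λ o → OutputAt Txs j o × o′ ≡ renameOutput to o
    renameOutputAt⁻ eq o∈ = ∈-map⁻ (renameOutput to) (Equivalence.from (proj₂ (at eq)) o∈)

    renameInputAt : toℕ j ≡ toℕ j′ → InputAt Txs j i → InputAt Txs′ j′ (renameInput to i)
    renameInputAt eq i∈ = Equivalence.to (proj₁ (at eq)) (∈-map⁺ (renameInput to) i∈)

    renameInputAt⁻ : toℕ j ≡ toℕ j′ → InputAt Txs′ j′ i′ →
                     ∃ λ i → InputAt Txs j i × i′ ≡ renameInput to i
    renameInputAt⁻ eq i∈ = ∈-map⁻ (renameInput to) (Equivalence.from (proj₁ (at eq)) i∈)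

    renameSpentAt : toℕ j ≡ toℕ j′ → SpentAt Txs j o → SpentAt Txs′ j′ (renameOutput to o)
    renameSpentAt eq (k , i , j<k , i∈ , i↦o) =
      let k′ , eq′ = forth k
      in k′ , renameInput to i , subst₂ _<_ eq eq′ j<k , renameInputAt eq′ i∈ , cong to i↦o

    -- Injectivity of the permutation reflects pointing, so renaming creates no new spending.
    renameSpentAt⁻ : toℕ j ≡ toℕ j′ → SpentAt Txs′ j′ (renameOutput to o) → SpentAt Txs j o
    renameSpentAt⁻ eq (k′ , _ , j<k , i∈ , i↦o) with back k′
    ... | k , eq′ with renameInputAt⁻ eq′ i∈
    ...   | i , i∈′ , refl =
      k , i , subst₂ _<_ (sym eq) (sym eq′) j<k , i∈′ , injective i↦o

    rename-UTxO : UTxO Txs o → UTxO Txs′ (renameOutput to o)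
    rename-UTxO {o = o} (j , o∈ , unspent) =
      let j′ , eq = forth j
      in j′ , renameOutputAt eq o∈ , unspent ∘ renameSpentAt⁻ {o = o} eq

    rename-UTxO⁻ : UTxO Txs′ o′ → ∃ λ o → UTxO Txs o × o′ ≡ renameOutput to o
    rename-UTxO⁻ (j′ , o′∈ , unspent) with back j′
    ... | j , eq with renameOutputAt⁻ eq o′∈
    ...   | o , o∈ , refl = o , (j , o∈ , unspent ∘ renameSpentAt {o = o} eq) , refl

    -- The unspent outputs of `Txs′` are the renamed unspent outputs of `Txs`, and the renaming acts
    -- on these as the identity.
    rename-≅ : FixesUnspent π Txs → Txs ≅ Txs′
    rename-≅ fixes =
      (λ u → subst (UTxO Txs′) (fixed u) (rename-UTxO u)) ,
      (λ u′ → let o , u , eq = rename-UTxO⁻ u′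
              in subst (UTxO Txs) (sym (trans eq (fixed u))) u)
      where
      fixed : UTxO Txs o → renameOutput to o ≡ o
      fixed {o = mkOutput _ V s x} u = cong (λ q → mkOutput q V s x) (fixes u)

    -- An unspent position of `Txs′` is the image of an unspent position of `Txs`, which the
    -- permutation fixes; its inverse therefore fixes it too.
    from-FixesUnspent : FixesUnspent π Txs → FixesUnspent (↔-sym π) Txs′
    from-FixesUnspent fixes u′ with rename-UTxO⁻ u′
    ... | _ , u , refl = trans (Inverse.strictlyInverseʳ π _) (sym (fixes u))

  ≋-refl : ∀ {Txs} → Pointwise _≈ᵗ_ Txs Txs
  ≋-refl = Pointwise.refl ≈ᵗ-refl

  =α⇒≅ : ∀ B B′ → B =α B′ → txs B ≅ txs B′
  =α⇒≅ _ _ (π , fixes , renamed) = Renaming.rename-≅ π renamed fixes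

  rename-inverse : ∀ π Txs → rename (↔-sym π) (rename π Txs) ≡ Txs
  rename-inverse π Txs = trans (sym (map-∘ Txs)) (map-id-local (All.universal renameTx-inverse Txs))
    where
    open Inverse π using (to; from; strictlyInverseʳ)

    renameTx-inverse : ∀ t → renameTx from (renameTx to t) ≡ t
    renameTx-inverse (transaction I O) = cong₂ transaction
      (trans (sym (map-∘ I)) (map-id-local
        (All.universal (λ (mkInput q k) → cong (λ q → mkInput q k) (strictlyInverseʳ q)) I)))
      (trans (sym (map-∘ O)) (map-id-local
        (All.universal (λ (mkOutput q V s x) → cong (λ q → mkOutput q V s x) (strictlyInverseʳ q)) O)))

  -- The relation leads from the renamed chain back to `B`, so its witness is the inverse
  -- permutation.
  rename-=α : (B : Blockchain) (π : ℕ ↔ ℕ) (fixes : FixesUnspent π (txs B))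
              (valid : Valid (rename π (txs B))) → (rename π (txs B) , valid) =α B
  rename-=α B π fixes _ =
    ↔-sym π , Renaming.from-FixesUnspent π {txs B} ≋-refl fixes ,
    subst (λ Txs → Pointwise _≈ᵗ_ Txs (txs B)) (sym (rename-inverse π (txs B))) ≋-refl

  -- An α-equivalent form whose inputs avoid the outputs of a given transaction.

  InputPosition : List Tx → Pred Position _
  InputPosition Txs q = ∃₂ λ k i → InputAt Txs k i × Input.position i ≡ q

  inputPosition? : ∀ Txs → Decidable (InputPosition Txs)
  inputPosition? Txs q = map′
    (λ (k , i∈) → k , find i∈)
    (λ (k , i , i∈ , eq) → k , lose i∈ eq)
    (Fin.any? λ k → Any.any? (λ i → Input.position i ≟ q) (inputs (lookup Txs k)))

  -- An input at this position has a strictly earlier source. Distinctness of output positions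
  -- identifies that source with the given occurrence, which would then be spent.
  unspent⇒¬InputPosition : ∀ Txs → Valid Txs → UTxO Txs o → ¬ InputPosition Txs (Output.position o)
  unspent⇒¬InputPosition Txs valid (j , o∈ , unspent) (k , i , i∈ , i↦o) with Valid.source valid i∈
  ... | _ , (o′∈ , j<k , i↦o′) , _
    with Valid.outputs-distinct valid o∈ o′∈ (trans (sym i↦o) i↦o′)
  ...   | refl = unspent (k , i , j<k , i∈ , i↦o)

  avoiding : PositionsIrrelevant → (B : Blockchain) (tx : Tx) →
             ∃ λ (B₁ : Blockchain) → B₁ =α B × AvoidsInputs (txs B₁) tx
  avoiding irrelevant B@(Txs , valid) tx =
    (rename π Txs , irrelevant B π fixes) , rename-=α B π fixes (irrelevant B π fixes) , avoids
    where
    -- Consing `tx` onto `Txs` puts the outputs of both under one bound: index `zero` is `tx`, and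
    -- `suc j` is place `j` of `Txs`. The `suc` makes the bound strict, and 0 is the default when
    -- there are no outputs.
    N = suc (max 0 (outputPositions (tx ∷ Txs)))

    output<N : ∀ {j} → OutputAt (tx ∷ Txs) j o → Output.position o < N
    output<N {j = j} o∈ = s≤s (All.lookup (xs≤max 0 _) (∈-outputPositions (tx ∷ Txs) {j} o∈))

    input<N : ∀ {q} → InputPosition Txs q → q < N
    -- An input sits at the position of its source, so the bound on outputs covers inputs.
    input<N (_ , _ , i∈ , refl) with Valid.source valid i∈
    ... | (j , _) , (o∈ , _ , i↦o) , _ = subst (_< N) (sym i↦o) (output<N {j = suc j} o∈)

    open Relocation (inputPosition? Txs) input<N renaming (relocation to π)

    fixes : FixesUnspent π Txs
    fixes u@(j , o∈ , _) =
      relocate-fixes (unspent⇒¬InputPosition Txs valid u) (output<N {j = suc j} o∈)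

    open Renaming π {Txs} ≋-refl using (back; renameInputAt⁻)

    avoids : AvoidsInputs (rename π Txs) tx
    avoids {k} i∈ o∈ i↦o with back k
    ... | k′ , eq with renameInputAt⁻ eq i∈
    -- The renamed input sits at `N` plus its former position, whereas every output of `tx` lies
    -- below `N`.
    ...   | i , i∈′ , refl = <⇒≱ (output<N {j = zero} o∈)
      (subst (N ≤_) (trans (sym (relocate-∈ (k′ , i , i∈′ , refl))) i↦o) (m≤m+n N _))

lemma2p21 : ∀ {v p} (S : EUTxO v p) → let open Ledger S in
    PositionsIrrelevant →
    (B B′ : Blockchain) (tx : Tx) →
    (txs B ≅ txs B′ → Valid (txs B ++ [ tx ]) → Valid (txs B′ ++ [ tx ]) →
    txs B ++ [ tx ] ≅ txs B′ ++ [ tx ])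
    × (B =α B′ → txs B ≅ txs B′)
    × (∃₂ λ (B₁ B₁′ : Blockchain) → B₁ =α B × B₁′ =α B′ ×
    (txs B₁ ≅ txs B₁′ → Valid (txs B₁ ++ [ tx ]) ⇔ Valid (txs B₁′ ++ [ tx ])))
    × (∃₂ λ (B₁ B₁′ : Blockchain) → B₁ =α B × B₁′ =α B′ ×
    (txs B₁ ≅ txs B₁′ → Valid (txs B₁ ++ [ tx ]) →
    txs B₁ ++ [ tx ] ≅ txs B₁′ ++ [ tx ]))
lemma2p21 S irrelevant B@(Txs , _) B′@(Txs′ , _) tx
  with avoiding S irrelevant B tx | avoiding S irrelevant B′ tx
... | B₁@(Txs₁ , valid₁) , B₁=αB , avoids₁ | B₁′@(Txs₁′ , valid₁′) , B₁′=αB′ , avoids₁′ =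
    (λ equiv _ _ → ≅-∷ʳ S Txs Txs′ equiv)
  , =α⇒≅ S B B′
  -- Each direction uses avoidance for its target chain, which is why both chains are renamed.
  , (B₁ , B₁′ , B₁=αB , B₁′=αB′ , λ equiv@(⊆ , ⊇) → mk⇔
      (Valid-∷ʳ-resp-≅ S Txs₁ Txs₁′ valid₁′ equiv avoids₁′)
      (Valid-∷ʳ-resp-≅ S Txs₁′ Txs₁ valid₁ (⊇ , ⊆) avoids₁))
  , (B₁ , B₁′ , B₁=αB , B₁′=αB′ , λ equiv _ → ≅-∷ʳ S Txs₁ Txs₁′ equiv)
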